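{- Let $(\Omega,S)$ be an equivalenced scheme of valency $k$ such that (A) for all $u,v\in S^\#$ and all $w,w'\in D(u,v)$ one has $\bigcap_{a\in\{u,v\},\,b\in\{w,w'\}}D(a,b)\ne\emptyset$, and (B) for all $u,v,w\in S^\#$ one has $D(u,v)\cap D(v,w)\cap D(w,u)\ne\emptyset$. Then for every $\alpha_0\in\Omega$ the set of basis relations of the $\alpha_0$-extension satisfies $S_{\alpha_0}=S_0(\alpha_0)\cup S_1(\alpha_0)$. In particular, the $\alpha_0$-extension $(\Omega,S_{\alpha_0})$ is semiregular on $\Omega_0=\Omega\setminus\{\alpha_0\}$ and its fibers are the sets $\alpha_0u$, $u\in S$.
   Context: A coherent configuration on a finite set $\Omega$ is a pair $(\Omega,T)$, $T$ a partition of $\Omega\times\Omega$, such that $1_\Omega=\{(\alpha,\alpha)\}$ is a union of elements of $T$, $T$ is closed under $r\mapsto r^*=\{(\beta,\alpha):(\alpha,\beta)\in r\}$, and $c_{rs}^t=|\{\beta:(\alpha,\beta)\in r,(\beta,\gamma)\in s\}|$ is independent of $(\alpha,\gamma)\in t$ for $r,s,t\in T$. Fibers are sets $\Delta$ with $1_\Delta\in T$. A scheme is a coherent configuration with $1_\Omega\in S$; $S^\#=S\setminus\{1_\Omega\}$; $\alpha s=\{\beta:(\alpha,\beta)\in s\}$; equivalenced of valency $k$ means $|\alpha s|=k$ for $s\in S^\#$. For relations $r,s$, $r\cdot s$ is their composition; for $r,s$ unions of basis relations, $rs$ is the set of basis relations in $r\cdot s$, and for sets $X,Y$ of relations $X\cdot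 Y=\{x\cdot y:x\in X,y\in Y\}$, $XY=\bigcup xy$. Splitting set: $D(u,v)=\{w\in S^\#:(uu^*\,vv^*)\cap ww^*=\{1_\Omega\}\}$. The $\alpha_0$-extension is the smallest coherent configuration $(\Omega,S_{\alpha_0})$ (fewest unions needed; i.e. coarsest) such that $\{(\alpha_0,\alpha_0)\}\in S_{\alpha_0}$ and every $s\in S$ is a union of elements of $S_{\alpha_0}$. It is semiregular on $\Omega_0$ if $|\beta s|\le1$ for all $\beta\in\Omega_0$ and all $s\in S_{\alpha_0}$ with $s\subseteq\Omega_0\times\Omega_0$. For $u,v\in S$: $S(u,v)=\{s\cap(\alpha_0u\times\alpha_0v):s\in u^*v\}$; $S(u,v;w)=S(u,w)\cdot S(w,v)$; $S_0(\alpha_0)=\bigcup_{u,v\in S^\#}\bigcup_{w\in D(u,v)}S(u,v;w)$; $S_1(\alpha_0)=\{\{\alpha_0\}\times\alpha_0v:v\in S\}\cup\{\alpha_0v\times\{\alpha_0\}:v\in S\}$. -}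

module Defs where

open import Level using (Level)
open import Data.Nat using (ℕ; zero; suc; _+_)
open import Data.Bool using (Bool; true; false; _∧_)
open import Data.Fin using (Fin; zero; suc; _≟_)
open import Data.Product using (Σ; ∃; ∃-syntax; _×_; _,_)
open import Data.Sum using (_⊎_)
open import Relation.Binary.PropositionalEquality using (_≡_; _≢_)
open import Relation.Nullary.Decidable using (⌊_⌋)
open import Function.Bundles using (_⇔_)

-- Conventions.
-- Ω = Fin n.  A partition of Ω×Ω into m (nonempty) classes is encoded by a
-- colouring  c : Fin n → Fin n → Fin m  which is surjective; the basis
-- relation with colour i is  Basis c i = {(a,b) : c a b ≡ i}.
-- Relations on Ω are predicates  Rel n = Fin n → Fin n → Set.

Rel : ℕ → Set₁
Rel n = Fin n → Fin n → Set

Colouring : ℕ → ℕ → Set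
Colouring n m = Fin n → Fin n → Fin m

count : ∀ {n} → (Fin n → Bool) → ℕ
count {zero}  p = 0
count {suc n} p with p zero
... | true  = suc (count (λ i → p (suc i)))
... | false = count (λ i → p (suc i))

_⨾_ : ∀ {n} → Rel n → Rel n → Rel n
(r ⨾ s) a g = Σ _ λ b → r a b × s b g

_ᵀ : ∀ {n} → Rel n → Rel n
(r ᵀ) a b = r b a

_⊆ʳ_ : ∀ {n} → Rel n → Rel n → Set
r ⊆ʳ s = ∀ a b → r a b → s a b

_≐_ : ∀ {n} → Rel n → Rel n → Set
r ≐ s = ∀ a b → r a b ⇔ s a b

Basis : ∀ {n m} → Colouring n m → Fin m → Rel n
Basis c i a b = c a b ≡ i

record IsCC {n m : ℕ} (c : Colouring n m) : Set where
  field
    nonempty  : ∀ i → ∃[ a ] ∃[ b ] c a b ≡ i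
    diagUnion : ∀ a b g → c a a ≡ c b g → b ≡ g
    converse  : ∀ i → ∃[ j ] (∀ a b → (c a b ≡ i) ⇔ (c b a ≡ j))
    interNum  : ∀ i j a g a' g' → c a g ≡ c a' g' →
                count (λ β → ⌊ c a β ≟ i ⌋ ∧ ⌊ c β g ≟ j ⌋)
                ≡ count (λ β → ⌊ c a' β ≟ i ⌋ ∧ ⌊ c β g' ≟ j ⌋)

-- e is the colour of the diagonal 1_Ω (so (Ω,c) is a scheme, S# = colours ≠ e)
IsDiagColour : ∀ {n m} → Colouring n m → Fin m → Set
IsDiagColour c e = ∀ a b → (c a b ≡ e) ⇔ (a ≡ b)

Equivalenced : ∀ {n m} → Colouring n m → Fin m → ℕ → Set
Equivalenced c e k = ∀ s → s ≢ e → ∀ a → count (λ b → ⌊ c a b ≟ s ⌋) ≡ k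

InComp : ∀ {n m} → Colouring n m → Rel n → Rel n → Fin m → Set
InComp c r s t = Basis c t ⊆ʳ (r ⨾ s)

UU* : ∀ {n m} → Colouring n m → Fin m → Fin m → Set
UU* c u t = InComp c (Basis c u) (Basis c u ᵀ) t

ProdSet : ∀ {n m} → Colouring n m → (Fin m → Set) → (Fin m → Set) → Fin m → Set
ProdSet c X Y t = ∃[ x ] ∃[ y ] (X x × Y y × InComp c (Basis c x) (Basis c y) t)

D : ∀ {n m} → Colouring n m → Fin m → Fin m → Fin m → Fin m → Set
D c e u v w = w ≢ e ×
  (∀ t → (ProdSet c (UU* c u) (UU* c v) t × UU* c w t) ⇔ (t ≡ e))

Cut : ∀ {n m} → Colouring n m → Fin n → Fin m → Fin m → Fin m → Rel n
Cut c α₀ s u v b g = c b g ≡ s × c α₀ b ≡ u × c α₀ g ≡ v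

InSuvw : ∀ {n m} → Colouring n m → Fin n → Fin m → Fin m → Fin m → Rel n → Set
InSuvw c α₀ u v w R = ∃[ s ] ∃[ s' ]
  ( InComp c (Basis c u ᵀ) (Basis c w) s
  × InComp c (Basis c w ᵀ) (Basis c v) s'
  × R ≐ (Cut c α₀ s u w ⨾ Cut c α₀ s' w v) )

InS₀ : ∀ {n m} → Colouring n m → Fin m → Fin n → Rel n → Set
InS₀ c e α₀ R = ∃[ u ] ∃[ v ] ∃[ w ]
  (u ≢ e × v ≢ e × D c e u v w × InSuvw c α₀ u v w R)

InS₁ : ∀ {n m} → Colouring n m → Fin n → Rel n → Set
InS₁ c α₀ R = ∃[ v ]
  ( (R ≐ (λ a b → a ≡ α₀ × c α₀ b ≡ v))
  ⊎ (R ≐ (λ a b → c α₀ a ≡ v × b ≡ α₀)) )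

Refines : ∀ {n m m'} → Colouring n m' → Colouring n m → Set
Refines d c = ∀ a b a' b' → d a b ≡ d a' b' → c a b ≡ c a' b'

SingletonBasis : ∀ {n m'} → Colouring n m' → Fin n → Set
SingletonBasis d α₀ = ∀ a b → (d a b ≡ d α₀ α₀) ⇔ (a ≡ α₀ × b ≡ α₀)

record IsExtension {n m m'} (c : Colouring n m) (α₀ : Fin n) (d : Colouring n m') : Set where
  field
    isCC      : IsCC d
    singleton : SingletonBasis d α₀
    refines   : Refines d c
    coarsest  : ∀ m'' (d' : Colouring n m'') → IsCC d' → SingletonBasis d' α₀ →
                Refines d' c → Refines d' d

IsFiber : ∀ {n m'} → Colouring n m' → (Fin n → Set) → Set
IsFiber d Δ = ∃[ j ] (Basis d j ≐ (λ a b → a ≡ b × Δ a))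

{-# OPTIONS --safe #-}
-- If uu* ∩ ww* = {1}, every s ∈ u*w restricts to a matching between the spheres α₀u and α₀w, because
-- s and u* have the same valency k.  For w ∈ D(u,v) there is a Helly property: if β, γ, δ are such
-- that each two of them lie on the u-, v-, w-spheres around some point, then one point serves all
-- three.  So two sides of a triangle over the spheres α₀u, α₀v, α₀w determine the third.
-- Condition (A) makes the class of a pair under composite matchings α₀u → α₀w → α₀v independent
-- of w, and condition (B) routes all three sides of a triangle through one sphere, which makes
-- these classes closed under composition.  They thus form a coherent configuration refining S, and
-- any coherent configuration that refines S and isolates α₀ must refine them.
module Submission where

open import Defs
open import Data.Nat using (ℕ; zero; suc; _≤_; z≤n; s≤s; _*_)
open import Data.Nat.Properties using (≤-antisym; suc-injective; 1+n≰n)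
open import Data.Bool using (Bool; true; false; _∧_; not)
open import Data.Bool.Properties using (∧-identityʳ)
open import Data.Fin using (Fin; zero; suc; _≟_; combine; remQuot)
open import Data.Fin.Properties using (any?; remQuot-combine; combine-remQuot)
import Data.Fin.Properties as Finₚ
open import Data.Product using (Σ-syntax; ∃-syntax; _×_; _,_; proj₁; proj₂)
open import Data.Sum using (_⊎_; inj₁; inj₂)
open import Data.Empty using (⊥-elim)
open import Relation.Nullary using (Dec; yes; no)
open import Relation.Nullary.Decidable using (⌊_⌋; _×-dec_; map′)
open import Relation.Binary.Structures using (IsEquivalence)
open import Relation.Binary.PropositionalEquality using (_≡_; _≢_; refl; sym; trans; cong; subst; subst₂)
open import Function.Bundles using (_⇔_; mk⇔; module Equivalence)
open import Function.Properties.Equivalence using () renaming (trans to ⇔-trans; sym to ⇔-sym)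
open Equivalence using (to; from)

-- Counting

_∖_ : ∀ {n} → (Fin n → Bool) → Fin n → Fin n → Bool
(p ∖ y) x = p x ∧ not ⌊ x ≟ y ⌋

∖-intro : ∀ {n} (p : Fin n → Bool) {x y} → p x ≡ true → x ≢ y → (p ∖ y) x ≡ true
∖-intro p {x} {y} px x≢y rewrite px with x ≟ y
... | yes x≡y = ⊥-elim (x≢y x≡y)
... | no  _   = refl

∖-elim : ∀ {n} (p : Fin n → Bool) {x y} → (p ∖ y) x ≡ true → p x ≡ true × x ≢ y
∖-elim p {x} {y} h with p x | x ≟ y | h
... | true | no x≢y | _ = refl , x≢y

count-cong : ∀ {n} {p q : Fin n → Bool} → (∀ x → p x ≡ q x) → count p ≡ count q
count-cong {zero}          p≡q = refl
count-cong {suc n} {p} {q} p≡q with p zero | q zero | p≡q zero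
... | true  | true  | _ = cong suc (count-cong (λ x → p≡q (suc x)))
... | false | false | _ = count-cong (λ x → p≡q (suc x))

∖-suc : ∀ {n} (p : Fin (suc n) → Bool) y x → ((λ i → p (suc i)) ∖ y) x ≡ (p ∖ suc y) (suc x)
∖-suc p y x with x ≟ y
... | yes _ = refl
... | no  _ = refl

count-∖ : ∀ {n} (p : Fin n → Bool) {y} → p y ≡ true → count p ≡ suc (count (p ∖ y))
count-∖ p {zero} py with p zero
count-∖ p {zero} refl | true = cong suc (count-cong (λ x → sym (∧-identityʳ (p (suc x)))))
count-∖ p {suc y} py with p zero
... | true  = cong suc (trans (count-∖ (λ i → p (suc i)) py) (cong suc (count-cong (∖-suc p y))))
... | false = trans (count-∖ (λ i → p (suc i)) py) (cong suc (count-cong (∖-suc p y)))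

count-∃ : ∀ {n N} (p : Fin n → Bool) → count p ≡ suc N → ∃[ x ] p x ≡ true
count-∃ {suc n} p h with p zero in eq
... | true  = zero , eq
... | false with count-∃ (λ i → p (suc i)) h
...   | x , px = suc x , px

-- Induction on the domain: the first member is sent to a partner `y₀`, which is then deleted from
-- `q`. As `y₀` has only one preimage, the remaining members keep their partners.
count-≤ : ∀ {n n'} (p : Fin n → Bool) (q : Fin n' → Bool) (R : Fin n → Fin n' → Set) →
          (∀ x → p x ≡ true → ∃[ y ] (q y ≡ true × R x y)) →
          (∀ {x x' y} → R x y → R x' y → x ≡ x') → count p ≤ count q
count-≤ {zero}  p q R total unique = z≤n
count-≤ {suc n} p q R total unique with p zero in eq
... | false = count-≤ (λ i → p (suc i)) q (λ i → R (suc i)) (λ x → total (suc x))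
                (λ r r' → Finₚ.suc-injective (unique r r'))
... | true with total zero eq
...   | y₀ , qy₀ , r₀ rewrite count-∖ q qy₀ =
  s≤s (count-≤ (λ i → p (suc i)) (q ∖ y₀) (λ i → R (suc i)) total'
    (λ r r' → Finₚ.suc-injective (unique r r')))
  where
  total' : ∀ x → p (suc x) ≡ true → ∃[ y ] ((q ∖ y₀) y ≡ true × R (suc x) y)
  total' x px with total (suc x) px
  ... | y , qy , r = y , ∖-intro q qy (λ { refl → Finₚ.0≢1+n (unique r₀ r) }) , r

count≤1 : ∀ {n} (p : Fin n → Bool) → (∀ {x y} → p x ≡ true → p y ≡ true → x ≡ y) → count p ≤ 1
count≤1 p unique =
  count-≤ p (λ (_ : Fin 1) → true) (λ x _ → p x ≡ true) (λ x px → zero , refl , px) unique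

-- Pigeonhole: if `x` had two partners, deleting `x` on the left and both partners on the right
-- would leave `R` total and injective, yet the left side would be larger by one.
functional-of-count : ∀ {n} (p q : Fin n → Bool) (R : Fin n → Fin n → Set) → count p ≡ count q →
  (∀ x → p x ≡ true → ∃[ y ] (q y ≡ true × R x y)) →
  (∀ {x x' y} → R x y → R x' y → x ≡ x') →
  ∀ {x y y'} → p x ≡ true → q y ≡ true → q y' ≡ true → R x y → R x y' → y ≡ y'
functional-of-count p q R p≡q total unique {x} {y} {y'} px qy qy' r r' with y ≟ y'
... | yes y≡y' = y≡y'
... | no  y≢y' = ⊥-elim (1+n≰n (subst (_≤ count (q' ∖ y')) size
        (count-≤ (p ∖ x) (q' ∖ y') R total' unique)))
  where
  q' = q ∖ y
  q'y' : q' y' ≡ true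
  q'y' = ∖-intro q qy' (λ eq → y≢y' (sym eq))
  size : count (p ∖ x) ≡ suc (count (q' ∖ y'))
  size = suc-injective (trans (sym (count-∖ p px))
    (trans p≡q (trans (count-∖ q qy) (cong suc (count-∖ q' q'y')))))
  total' : ∀ z → (p ∖ x) z ≡ true → ∃[ t ] ((q' ∖ y') t ≡ true × R z t)
  total' z pz with ∖-elim p pz
  ... | pz' , z≢x with total z pz'
  ...   | t , qt , rt = t , ∖-intro q' (∖-intro q qt (λ { refl → z≢x (unique rt r) }))
                                      (λ { refl → z≢x (unique rt r') }) , rt

⌊≟⌋-intro : ∀ {m} {i j : Fin m} → i ≡ j → ⌊ i ≟ j ⌋ ≡ true
⌊≟⌋-intro {i = i} {j} i≡j with i ≟ j
... | yes _   = refl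
... | no  i≢j = ⊥-elim (i≢j i≡j)

⌊≟⌋-elim : ∀ {m} {i j : Fin m} → ⌊ i ≟ j ⌋ ≡ true → i ≡ j
⌊≟⌋-elim {i = i} {j} h with i ≟ j | h
... | yes i≡j | _ = i≡j

∧-intro : ∀ {x y} → x ≡ true → y ≡ true → x ∧ y ≡ true
∧-intro refl refl = refl

∧-elim : ∀ {x y} → x ∧ y ≡ true → x ≡ true × y ≡ true
∧-elim {true} {true} _ = refl , refl

-- Quotients of finite sets

-- Numbers the equivalence classes. By induction, `zero` either joins the class of a later element
-- or opens a new one.
quotient : ∀ N (_~_ : Fin N → Fin N → Set) → IsEquivalence _~_ → (∀ x y → Dec (x ~ y)) →
  ∃[ M ] Σ[ f ∈ (Fin N → Fin M) ] ((∀ i → ∃[ x ] f x ≡ i) × (∀ x y → (f x ≡ f y) ⇔ (x ~ y)))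
quotient zero    _~_ eqv dec = 0 , (λ ()) , (λ ()) , (λ ())
quotient (suc N) _~_ eqv dec
  with quotient N (λ x y → suc x ~ suc y)
         (record { refl = IsEquivalence.refl eqv ; sym = IsEquivalence.sym eqv
                 ; trans = IsEquivalence.trans eqv })
         (λ x y → dec (suc x) (suc y))
     | any? (λ x → dec zero (suc x))
... | M , f , onto , ker | yes (x₀ , r₀) = M , g , onto' , ker'
  where
  open IsEquivalence eqv renaming (refl to ~-refl; sym to ~-sym; trans to ~-trans)
  g : Fin (suc N) → Fin M
  g zero    = f x₀
  g (suc x) = f x
  onto' : ∀ i → ∃[ x ] g x ≡ i
  onto' i = suc (proj₁ (onto i)) , proj₂ (onto i)
  ker' : ∀ x y → (g x ≡ g y) ⇔ (x ~ y)
  ker' zero    zero    = mk⇔ (λ _ → ~-refl) (λ _ → refl)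
  ker' zero    (suc y) = mk⇔ (λ h → ~-trans r₀ (to (ker x₀ y) h))
                             (λ h → from (ker x₀ y) (~-trans (~-sym r₀) h))
  ker' (suc x) zero    = mk⇔ (λ h → ~-trans (to (ker x x₀) h) (~-sym r₀))
                             (λ h → from (ker x x₀) (~-trans h r₀))
  ker' (suc x) (suc y) = ker x y
... | M , f , onto , ker | no none = suc M , g , onto' , ker'
  where
  open IsEquivalence eqv renaming (refl to ~-refl; sym to ~-sym; trans to ~-trans)
  g : Fin (suc N) → Fin (suc M)
  g zero    = zero
  g (suc x) = suc (f x)
  onto' : ∀ i → ∃[ x ] g x ≡ i
  onto' zero    = zero , refl
  onto' (suc i) = suc (proj₁ (onto i)) , cong suc (proj₂ (onto i))
  ker' : ∀ x y → (g x ≡ g y) ⇔ (x ~ y)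
  ker' zero    zero    = mk⇔ (λ _ → ~-refl) (λ _ → refl)
  ker' zero    (suc y) = mk⇔ (λ ()) (λ h → ⊥-elim (none (y , h)))
  ker' (suc x) zero    = mk⇔ (λ ()) (λ h → ⊥-elim (none (x , ~-sym h)))
  ker' (suc x) (suc y) = mk⇔ (λ h → to (ker x y) (Finₚ.suc-injective h)) (λ h → cong suc (from (ker x y) h))

quotient₂ : ∀ {n} (_~_ : Fin n × Fin n → Fin n × Fin n → Set) → IsEquivalence _~_ →
  (∀ p q → Dec (p ~ q)) →
  ∃[ M ] Σ[ d ∈ Colouring n M ] ((∀ i → ∃[ a ] ∃[ b ] d a b ≡ i) ×
    (∀ a b a' b' → (d a b ≡ d a' b') ⇔ ((a , b) ~ (a' , b'))))
quotient₂ {n} _~_ eqv dec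
  with quotient (n * n) (λ x y → remQuot {n} n x ~ remQuot {n} n y)
         (record { refl = IsEquivalence.refl eqv ; sym = IsEquivalence.sym eqv
                 ; trans = IsEquivalence.trans eqv })
         (λ x y → dec (remQuot {n} n x) (remQuot {n} n y))
... | M , f , onto , ker = M , (λ a b → f (combine a b)) , onto' , ker'
  where
  onto' : ∀ i → ∃[ a ] ∃[ b ] f (combine a b) ≡ i
  onto' i with onto i
  ... | x , fx≡i = proj₁ (remQuot {n} n x) , proj₂ (remQuot {n} n x) ,
                   trans (cong f (combine-remQuot {n} n x)) fx≡i
  ker' : ∀ a b a' b' → (f (combine a b) ≡ f (combine a' b')) ⇔ ((a , b) ~ (a' , b'))
  ker' a b a' b' =
    subst₂ (λ p q → (f (combine a b) ≡ f (combine a' b')) ⇔ (p ~ q))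
      (remQuot-combine a b) (remQuot-combine a' b') (ker (combine a b) (combine a' b'))

-- Coherent configurations

module Coherent {n m} (c : Colouring n m) (cc : IsCC c) where
  open IsCC cc

  flip : ∀ {a b a' b'} → c a b ≡ c a' b' → c b a ≡ c b' a'
  flip {a} {b} {a'} {b'} eq with converse (c a b)
  ... | j , h = trans (to (h a b) refl) (sym (to (h a' b') (sym eq)))

  -- The intersection number counting `β` over `(a , g)` is positive, hence so is the equal one over
  -- `(a' , g')`. Nearly all coherence arguments below go through this.
  transport : ∀ {a g a' g'} → c a g ≡ c a' g' → ∀ β →
              ∃[ β' ] (c a β ≡ c a' β' × c β g ≡ c β' g')
  transport {a} {g} {a'} {g'} eq β
    with count-∃ q (trans (sym (interNum (c a β) (c β g) a g a' g' eq))
                          (count-∖ p (∧-intro (⌊≟⌋-intro {i = c a β} refl) (⌊≟⌋-intro {i = c β g} refl))))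
    where
    p = λ x → ⌊ c a x ≟ c a β ⌋ ∧ ⌊ c x g ≟ c β g ⌋
    q = λ x → ⌊ c a' x ≟ c a β ⌋ ∧ ⌊ c x g' ≟ c β g ⌋
  ... | β' , h with ∧-elim h
  ...   | h₁ , h₂ = β' , sym (⌊≟⌋-elim h₁) , sym (⌊≟⌋-elim h₂)

  -- Transporting the degenerate path through `a` itself yields a point `x`, and `diagUnion` forces
  -- `x` to be `a'`.
  source : ∀ {a b a' b'} → c a b ≡ c a' b' → c a a ≡ c a' a'
  source {a} {b} {a'} eq with transport eq a
  ... | x , aa≡a'x , _ with diagUnion a a' x aa≡a'x
  ...   | refl = aa≡a'x

  inComp : ∀ {a b} β → InComp c (Basis c (c a β)) (Basis c (c β b)) (c a b)
  inComp β x y eq with transport (sym eq) β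
  ... | β' , h₁ , h₂ = β' , sym h₁ , sym h₂

  common : ∀ {ω x y x' y'} → c x y ≡ c x' y' → ∃[ ω' ] (c ω' x' ≡ c ω x × c ω' y' ≡ c ω y)
  common {ω} eq with transport eq ω
  ... | ω' , h₁ , h₂ = ω' , flip (sym h₁) , sym h₂

-- Separation, the Helly property and matchings in a scheme

module Scheme {n m} (c : Colouring n m) (e : Fin m) (k : ℕ)
              (cc : IsCC c) (diag : IsDiagColour c e) (equi : Equivalenced c e k) where
  open IsCC cc
  open Coherent c cc

  -- All diagonal pairs share one colour, so a `v`-edge found at some `x` can be transported to `a`.
  neighbour : ∀ a v → ∃[ b ] c a b ≡ v
  neighbour a v with nonempty v
  ... | x , y , refl with transport {x} {x} {a} {a} (trans (from (diag x x) refl) (sym (from (diag a a) refl))) y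
  ...   | b , xy≡ab , _ = b , sym xy≡ab

  -- The condition that `uu*` and `ww*` meet only in the diagonal, read at points.
  Separated : Fin m → Fin m → Set
  Separated u w = ∀ {α α' β δ} → c α β ≡ u → c α' β ≡ u → c α δ ≡ w → c α' δ ≡ w → α ≡ α'

  separated-sym : ∀ {u w} → Separated u w → Separated w u
  separated-sym sep αβ α'β αδ α'δ = sep αδ α'δ αβ α'β

  Helly : Fin m → Fin m → Fin m → Set
  Helly u v w = ∀ {x y z α β γ} → c α x ≡ u → c α y ≡ v → c β y ≡ v → c β z ≡ w →
                c γ z ≡ w → c γ x ≡ u → ∃[ ω ] (c ω x ≡ u × c ω y ≡ v × c ω z ≡ w)

  helly-swap : ∀ {u v w} → Helly u v w → Helly u w v
  helly-swap H αx αy βy βz γz γx with H γx γz βz βy αy αx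
  ... | ω , ωx , ωz , ωy = ω , ωx , ωy , ωz

  uu* : ∀ {α α' β u} → c α β ≡ u → c α' β ≡ u → UU* c u (c α α')
  uu* {β = β} refl α'β x y eq with transport (sym eq) β
  ... | β' , h₁ , h₂ = β' , sym h₁ , trans (flip (sym h₂)) α'β

  D-cong : ∀ {u u' v v' w w'} → u ≡ u' → v ≡ v' → w ≡ w' → D c e u v w → D c e u' v' w'
  D-cong refl refl refl spl = spl

  -- The path from `α` via `β`, `ξ`, `γ` to `α'` puts the pair into `uu*vv*`, while `δ` puts it into
  -- `ww*`; only the diagonal colour lies in both.
  D-pointwise : ∀ {u v w α α' ξ β γ δ} → D c e u v w → c α β ≡ u → c ξ β ≡ u →
                c ξ γ ≡ v → c α' γ ≡ v → c α δ ≡ w → c α' δ ≡ w → α ≡ α'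
  D-pointwise {α = α} {α'} {ξ} (_ , spl) αβ ξβ ξγ α'γ αδ α'δ =
    to (diag α α') (to (spl (c α α'))
      ((c α ξ , c ξ α' , uu* αβ ξβ , uu* ξγ α'γ , inComp ξ) , uu* αδ α'δ))

  -- Take `ξ = α'`: the diagonal lies in `vv*`, so `uu*` is contained in `uu*vv*`.
  separated₁ : ∀ {u v w} → D c e u v w → Separated u w
  separated₁ {v = v} spl {α' = α'} αβ α'β αδ α'δ with neighbour α' v
  ... | γ , α'γ = D-pointwise spl αβ α'β α'γ α'γ αδ α'δ

  separated₂ : ∀ {u v w} → D c e u v w → Separated v w
  separated₂ {u} spl {α = α} αγ α'γ αδ α'δ with neighbour α u
  ... | β , αβ = D-pointwise spl αβ αβ αγ α'γ αδ α'δ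

  -- The centres `γ` and `β` are joined in `uu*vv*` through `x`, `α`, `y` and in `ww*` through `z`.
  -- So they coincide, and this point serves all three.
  helly : ∀ {u v w} → D c e u v w → Helly u v w
  helly spl αx αy βy βz γz γx with D-pointwise spl γx αx αy βy γz βz
  ... | refl = _ , γx , βy , βz

  -- Each s ∈ u*w with s ≢ e maps β s onto β u*, two sets of size k.
  matching : ∀ {u w α β δ δ'} → u ≢ e → Separated u w → c α β ≡ u → c α δ ≡ w → c α δ' ≡ w →
             c β δ ≡ c β δ' → δ ≡ δ'
  matching {u} {w} {α} {β} {δ} {δ'} u≢e sep αβ αδ αδ' eq with c β δ ≟ e
  ... | yes βδ≡e = trans (sym (to (diag β δ) βδ≡e)) (to (diag β δ') (trans (sym eq) βδ≡e))
  ... | no  βδ≢e =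
    functional-of-count p q R
      (trans (equi _ βα≢e β) (sym (equi _ βδ≢e β))) total
      (λ { (xβ , xy) (x'β , x'y) → sep xβ x'β xy x'y })
      (⌊≟⌋-intro {i = c β α} refl) (⌊≟⌋-intro {i = c β δ} refl) (⌊≟⌋-intro (sym eq))
      (αβ , αδ) (αβ , αδ')
    where
    p = λ x → ⌊ c β x ≟ c β α ⌋
    q = λ y → ⌊ c β y ≟ c β δ ⌋
    R = λ x y → c x β ≡ u × c x y ≡ w
    βα≢e : c β α ≢ e
    βα≢e h = u≢e (trans (sym αβ) (from (diag α β) (sym (to (diag β α) h))))
    total : ∀ x → p x ≡ true → ∃[ y ] (q y ≡ true × R x y)
    total x px with flip (⌊≟⌋-elim px)
    ... | xβ with transport (sym xβ) δ
    ...   | y , h₁ , h₂ = y , ⌊≟⌋-intro (flip (sym h₂)) , trans xβ αβ , trans (sym h₁) αδ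

-- Classes of pairs under composite matchings

module Extension {n m} (c : Colouring n m) (e : Fin m) (k : ℕ)
  (cc : IsCC c) (diag : IsDiagColour c e) (equi : Equivalenced c e k)
  (hypA : ∀ u v → u ≢ e → v ≢ e → ∀ w w' → D c e u v w → D c e u v w' →
    ∃[ z ] (D c e u w z × D c e u w' z × D c e v w z × D c e v w' z))
  (hypB : ∀ u v w → u ≢ e → v ≢ e → w ≢ e →
    ∃[ z ] (D c e u v z × D c e v w z × D c e w u z))
  (α₀ : Fin n) where
  open Coherent c cc
  open Scheme c e k cc diag equi

  col : Fin n → Fin m
  col = c α₀

  col≢e : ∀ {a} → a ≢ α₀ → col a ≢ e
  col≢e a≢α₀ h = a≢α₀ (sym (to (diag α₀ _) h))

  ≢α₀ : ∀ {a} → col a ≢ e → a ≢ α₀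
  ≢α₀ col≢ refl = col≢ (from (diag α₀ α₀) refl)

  col-≡α₀ : ∀ {a} → col α₀ ≡ col a → a ≡ α₀
  col-≡α₀ eq = sym (to (diag α₀ _) (trans (sym eq) (from (diag α₀ α₀) refl)))

  extend : ∀ {a a'} → col a ≡ col a' → ∀ b → ∃[ b' ] (col b ≡ col b' × c a b ≡ c a' b')
  extend eq b with transport eq b
  ... | b' , h₁ , h₂ = b' , h₁ , flip h₂

  -- Transport gives `t` over `(x' , y')` coloured like `z` over `(x , y)`, but perhaps off the
  -- sphere of `z'`. The steps below put `t` on that sphere and then identify it with `z'`.
  triangle : ∀ {x y z x' y' z'} → col y ≢ e →
    Separated (col x) (col y) → Separated (col y) (col z) → Helly (col x) (col y) (col z) →
    col x ≡ col x' → col y ≡ col y' → col z ≡ col z' →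
    c x y ≡ c x' y' → c y z ≡ c y' z' → c x z ≡ c x' z'
  triangle {x} {y} {z} {x'} {y'} {z'} y≢e sepxy sepyz H xx' yy' zz' xy yz
    with transport xy z
  -- `γ` is a centre for `x'` and `t`, `β` one for `y'` and `t`; `α₀` is already one for `x'` and
  -- `y'`.
  ... | t , xz , zy with common {α₀} xz | common {α₀} (flip zy)
  ... | γ , γx' , γt | β , βy' , βt
    with H (sym xx') (sym yy') βy' βt γt γx'
  -- The common centre `ω` shares `x'` and `y'` with `α₀`, so separation makes it `α₀`. Then `t` and
  -- `z'` are matched with the same `y'` by the same colour.
  ... | ω , ωx' , ωy' , ωt with sepxy ωx' (sym xx') ωy' (sym yy')
  ... | refl with matching y≢e sepyz (sym yy') ωt (sym zz') (trans (sym (flip zy)) yz)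
  ... | refl = xz

  Linked : (a b a' b' δ δ' : Fin n) → Set
  Linked a b a' b' δ δ' = col δ ≡ col δ' × c a δ ≡ c a' δ' × c δ b ≡ c δ' b'

  -- The matchings through δ and through δ₁ are compared through a sphere z separated from both.
  relink : ∀ {a b a' b' δ δ'} → a ≢ α₀ → b ≢ α₀ → col a ≡ col a' → col b ≡ col b' →
    D c e (col a) (col b) (col δ) → Linked a b a' b' δ δ' →
    ∀ δ₁ → D c e (col a) (col b) (col δ₁) → ∃[ δ₁' ] Linked a b a' b' δ₁ δ₁'
  relink {a} {b} {δ = δ} a≢ b≢ aa' bb' Dδ (δδ' , aδ , δb) δ₁ Dδ₁
    with hypA (col a) (col b) (col≢e a≢) (col≢e b≢) (col δ) (col δ₁) Dδ Dδ₁
  ... | z , Duw , Duw' , Dvw , Dvw' with neighbour α₀ z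
  ... | ζ , refl with extend δδ' ζ
  ... | ζ' , ζζ' , δζ with extend ζζ' δ₁
  ... | δ₁' , δ₁δ₁' , ζδ₁ = δ₁' , δ₁δ₁' , aδ₁ , flip bδ₁
    where
    -- The points `ζ'` and `δ₁'` were chosen to agree along `δζ` and `ζδ₁` only. The first two
    -- triangles carry agreement with `a` and `b` from `δ` to `ζ`, the last two from `ζ` to `δ₁`.
    aζ = triangle (proj₁ Dδ) (separated₁ Dδ) (separated₂ Duw) (helly Duw) aa' δδ' ζζ' aδ δζ
    bζ = triangle (proj₁ Dδ) (separated₂ Dδ) (separated₂ Dvw) (helly Dvw) bb' δδ' ζζ' (flip δb) δζ
    aδ₁ = triangle (proj₁ Duw) (separated₁ Duw') (separated-sym (separated₂ Duw'))
            (helly-swap (helly Duw')) aa' ζζ' δ₁δ₁' aζ ζδ₁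
    bδ₁ = triangle (proj₁ Dvw) (separated₁ Dvw') (separated-sym (separated₂ Dvw'))
            (helly-swap (helly Dvw')) bb' ζζ' δ₁δ₁' bζ ζδ₁

  -- Quantifying over every admissible `δ` makes transitivity immediate; by `link`, a single `δ` is
  -- enough to establish it. A pair touching `α₀` is classified by spheres alone, as in `S₁`.
  record Sim (a b a' b' : Fin n) : Set where
    constructor sim
    field
      left   : col a ≡ col a'
      right  : col b ≡ col b'
      linked : a ≢ α₀ → b ≢ α₀ → ∀ δ → D c e (col a) (col b) (col δ) →
               ∃[ δ' ] Linked a b a' b' δ δ'
  open Sim

  link : ∀ {a b a' b' δ δ'} → col a ≡ col a' → col b ≡ col b' →
    D c e (col a) (col b) (col δ) → Linked a b a' b' δ δ' → Sim a b a' b'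
  link aa' bb' Dδ l = sim aa' bb' (λ a≢ b≢ → relink a≢ b≢ aa' bb' Dδ l)

  simˡ : ∀ {b b'} → col b ≡ col b' → Sim α₀ b α₀ b'
  simˡ bb' = sim refl bb' (λ α₀≢ → ⊥-elim (α₀≢ refl))

  simʳ : ∀ {a a'} → col a ≡ col a' → Sim a α₀ a' α₀
  simʳ aa' = sim aa' refl (λ _ α₀≢ → ⊥-elim (α₀≢ refl))

  -- Condition (B) at points. With `g = a` it serves as a supply of points whose colour splits `a`
  -- and `b`, in both orders.
  middle : ∀ {a b g} → a ≢ α₀ → b ≢ α₀ → g ≢ α₀ → ∃[ δ ]
    (D c e (col a) (col b) (col δ) × D c e (col b) (col g) (col δ) × D c e (col g) (col a) (col δ))
  middle a≢ b≢ g≢ with hypB _ _ _ (col≢e a≢) (col≢e b≢) (col≢e g≢)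
  ... | z , Ds with neighbour α₀ z
  ... | δ , refl = δ , Ds

  same-≢α₀ : ∀ {a a'} → col a ≡ col a' → a ≢ α₀ → a' ≢ α₀
  same-≢α₀ eq a≢ refl = a≢ (col-≡α₀ (sym eq))

  sim-refl : ∀ {a b} → Sim a b a b
  sim-refl = sim refl refl (λ _ _ δ _ → δ , refl , refl , refl)

  sim-trans : ∀ {a b a' b' a'' b''} → Sim a b a' b' → Sim a' b' a'' b'' → Sim a b a'' b''
  sim-trans s s' = sim (trans (left s) (left s')) (trans (right s) (right s')) linked'
    where
    linked' : _
    linked' a≢ b≢ δ Dδ with linked s a≢ b≢ δ Dδ
    ... | δ' , l₁ , l₂ , l₃
      with linked s' (same-≢α₀ (left s) a≢) (same-≢α₀ (right s) b≢) δ'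
             (D-cong (left s) (right s) l₁ Dδ)
    ... | δ'' , l₁' , l₂' , l₃' = δ'' , trans l₁ l₁' , trans l₂ l₂' , trans l₃ l₃'

  sim-sym : ∀ {a b a' b'} → Sim a b a' b' → Sim a' b' a b
  sim-sym {a} {b} s with a ≟ α₀ | b ≟ α₀
  ... | yes refl | _ with col-≡α₀ (left s)
  ...   | refl = simˡ (sym (right s))
  sim-sym s | no _ | yes refl with col-≡α₀ (right s)
  ... | refl = simʳ (sym (left s))
  sim-sym s | no a≢ | no b≢ with middle a≢ b≢ a≢
  ... | δ , Dδ , _ with linked s a≢ b≢ δ Dδ
  ... | δ' , l₁ , l₂ , l₃ =
    link (sym (left s)) (sym (right s))
      (D-cong (left s) (right s) l₁ Dδ)
      (sym l₁ , sym l₂ , sym l₃)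

  sim-flip : ∀ {a b a' b'} → Sim a b a' b' → Sim b a b' a'
  sim-flip {a} {b} s with a ≟ α₀ | b ≟ α₀
  ... | yes refl | _ with col-≡α₀ (left s)
  ...   | refl = simʳ (right s)
  sim-flip s | no _ | yes refl with col-≡α₀ (right s)
  ... | refl = simˡ (left s)
  sim-flip s | no a≢ | no b≢ with middle a≢ b≢ a≢
  ... | δ , Dab , Dba , _ with linked s a≢ b≢ δ Dab
  ... | δ' , l₁ , l₂ , l₃ = link (right s) (left s) Dba (l₁ , flip l₃ , flip l₂)

  -- Away from `α₀` one fixed `δ` decides the matter, so a finite search for `δ'` suffices.
  sim? : ∀ a b a' b' → Dec (Sim a b a' b')
  sim? a b a' b' with col a ≟ col a' | col b ≟ col b' | a ≟ α₀ | b ≟ α₀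
  ... | no ¬l   | _       | _        | _ = no (λ s → ¬l (left s))
  ... | yes _   | no ¬r   | _        | _ = no (λ s → ¬r (right s))
  ... | yes aa' | yes bb' | yes refl | _ = yes (sim aa' bb' (λ α₀≢ → ⊥-elim (α₀≢ refl)))
  ... | yes aa' | yes bb' | no _ | yes refl = yes (sim aa' bb' (λ _ α₀≢ → ⊥-elim (α₀≢ refl)))
  ... | yes aa' | yes bb' | no a≢ | no b≢ with middle a≢ b≢ a≢
  ...   | δ , Dδ , _ =
    map′ (λ { (_ , l) → link aa' bb' Dδ l }) (λ s → linked s a≢ b≢ δ Dδ)
      (any? (λ δ' → (col δ ≟ col δ') ×-dec (c a δ ≟ c a' δ') ×-dec (c δ b ≟ c δ' b')))

  -- Both halves of the route, from `a` to `δ` and from `δ` to `b`, are matchings, hence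
  -- single-valued.
  sim-unique : ∀ {a b b'} → a ≢ α₀ → Sim a b a b' → b ≡ b'
  sim-unique {a} {b} a≢ s with b ≟ α₀
  ... | yes refl = sym (col-≡α₀ (right s))
  ... | no b≢ with middle a≢ b≢ a≢
  ... | δ , Dδ , _ with linked s a≢ b≢ δ Dδ
  ... | δ' , l₁ , l₂ , l₃
    with matching (col≢e a≢) (separated₁ Dδ) refl refl (sym l₁) l₂
  ... | refl = matching (proj₁ Dδ) (separated-sym (separated₂ Dδ)) refl refl (sym (right s)) l₃

  -- The route to `δ` and back along the same edge can be copied from `a` to `b`.
  sim-diag : ∀ {a b} → col a ≡ col b → Sim a a b b
  sim-diag {a} eq with a ≟ α₀
  ... | yes refl with col-≡α₀ eq
  ...   | refl = sim-refl
  sim-diag eq | no a≢ with middle a≢ a≢ a≢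
  ... | δ , Dδ , _ with extend eq δ
  ... | δ' , δδ' , aδ = link eq eq Dδ (δδ' , aδ , flip aδ)

  sim-refines : ∀ {a b a' b'} → Sim a b a' b' → c a b ≡ c a' b'
  sim-refines {a} {b} s with a ≟ α₀ | b ≟ α₀
  ... | yes refl | _ with col-≡α₀ (left s)
  ...   | refl = right s
  sim-refines s | no _ | yes refl with col-≡α₀ (right s)
  ... | refl = flip (left s)
  sim-refines s | no a≢ | no b≢ with middle a≢ b≢ a≢
  ... | δ , Dδ , _ with linked s a≢ b≢ δ Dδ
  ... | δ' , l₁ , l₂ , l₃ =
    triangle (proj₁ Dδ) (separated₁ Dδ) (separated-sym (separated₂ Dδ)) (helly-swap (helly Dδ))
      (left s) l₁ (right s) l₂ l₃

  sim-extend : ∀ {a a'} → col a ≡ col a' → ∀ x → ∃[ x' ] Sim a x a' x'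
  sim-extend {a} eq x with a ≟ α₀ | x ≟ α₀
  ... | yes refl | _ with col-≡α₀ eq
  ...   | refl = x , sim-refl
  sim-extend eq x | no _ | yes refl = α₀ , simʳ eq
  sim-extend eq x | no a≢ | no x≢ with middle a≢ x≢ a≢
  ... | δ , Dδ , _ with extend eq δ
  ... | δ' , δδ' , aδ with extend δδ' x
  ... | x' , xx' , δx = x' , link eq xx' Dδ (δδ' , aδ , δx)

  -- This is closure of the classes under composition, from which the intersection numbers follow.
  sim-transport : ∀ {a g a' g'} → Sim a g a' g' → ∀ x → ∃[ x' ] (Sim a x a' x' × Sim x g x' g')
  sim-transport {a} {g} s x with a ≟ α₀ | g ≟ α₀ | x ≟ α₀
  sim-transport s x | _ | _ | yes refl = α₀ , simʳ (left s) , simˡ (right s)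
  sim-transport s x | yes refl | _ | no _ with col-≡α₀ (left s) | sim-extend (right s) x
  ... | refl | x' , t = x' , simˡ (right t) , sim-flip t
  sim-transport s x | no _ | yes refl | no _ with col-≡α₀ (right s) | sim-extend (left s) x
  ... | refl | x' , t = x' , t , simʳ (right t)
  -- One `δ` serves all three sides: `δ'` comes from the side `ga`, `x'` is then matched with `δ'`,
  -- and the sides `ax` and `xg` are linked through the same pair.
  sim-transport s x | no a≢ | no g≢ | no x≢ with middle a≢ x≢ g≢
  ... | δ , Dax , Dxg , Dga with linked (sim-flip s) g≢ a≢ δ Dga
  ... | δ' , δδ' , gδ , δa with extend δδ' x
  ... | x' , xx' , δx =
    x' , link (left s) xx' Dax (δδ' , flip δa , δx) , link xx' (right s) Dxg (δδ' , flip δx , flip gδ)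

  -- The coherent configuration formed by these classes

  module SimColouring {M} (d : Colouring n M)
    (onto : ∀ i → ∃[ a ] ∃[ b ] d a b ≡ i)
    (ker : ∀ a b a' b' → (d a b ≡ d a' b') ⇔ Sim a b a' b') where

    -- Transport relates each intermediate `x` to some `y`. An end other than `α₀` is required for
    -- injectivity, since `sim-unique` needs such a base point.
    count-mono : ∀ {a g a' g'} i j → a ≢ α₀ ⊎ g ≢ α₀ → Sim a g a' g' →
      count (λ x → ⌊ d a x ≟ i ⌋ ∧ ⌊ d x g ≟ j ⌋)
      ≤ count (λ x → ⌊ d a' x ≟ i ⌋ ∧ ⌊ d x g' ≟ j ⌋)
    count-mono {a} {g} {a'} {g'} i j off s =
      count-≤ _ _ (λ x y → Sim a x a' y × Sim x g y g') total (unique off)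
      where
      total : ∀ x → ⌊ d a x ≟ i ⌋ ∧ ⌊ d x g ≟ j ⌋ ≡ true →
        ∃[ y ] (⌊ d a' y ≟ i ⌋ ∧ ⌊ d y g' ≟ j ⌋ ≡ true × (Sim a x a' y × Sim x g y g'))
      total x h with ∧-elim h | sim-transport s x
      ... | h₁ , h₂ | y , s₁ , s₂ = y ,
        ∧-intro (⌊≟⌋-intro (trans (sym (from (ker _ _ _ _) s₁)) (⌊≟⌋-elim h₁)))
                (⌊≟⌋-intro (trans (sym (from (ker _ _ _ _) s₂)) (⌊≟⌋-elim h₂))) , s₁ , s₂
      unique : a ≢ α₀ ⊎ g ≢ α₀ → ∀ {x x' y} →
        Sim a x a' y × Sim x g y g' → Sim a x' a' y × Sim x' g y g' → x ≡ x'
      unique (inj₁ a≢) (s₁ , _) (t₁ , _) = sim-unique a≢ (sim-trans s₁ (sim-sym t₁))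
      unique (inj₂ g≢) (_ , s₂) (_ , t₂) =
        sim-unique g≢ (sim-flip (sim-trans s₂ (sim-sym t₂)))

    count-≡ : ∀ {a g a' g'} i j → Sim a g a' g' →
      count (λ x → ⌊ d a x ≟ i ⌋ ∧ ⌊ d x g ≟ j ⌋)
      ≡ count (λ x → ⌊ d a' x ≟ i ⌋ ∧ ⌊ d x g' ≟ j ⌋)
    count-≡ {a} {g} i j s with a ≟ α₀ | g ≟ α₀
    -- If both ends are `α₀`, the two pairs are equal.
    ... | yes refl | yes refl with col-≡α₀ (left s) | col-≡α₀ (right s)
    ...   | refl | refl = refl
    count-≡ i j s | no a≢ | _ =
      ≤-antisym (count-mono i j (inj₁ a≢) s)
                (count-mono i j (inj₁ (same-≢α₀ (left s) a≢)) (sim-sym s))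
    count-≡ i j s | yes _ | no g≢ =
      ≤-antisym (count-mono i j (inj₂ g≢) s)
                (count-mono i j (inj₂ (same-≢α₀ (right s) g≢)) (sim-sym s))

    isCC : IsCC d
    isCC = record
      { nonempty  = onto
      ; diagUnion = λ a b g eq →
          to (diag b g) (trans (sym (sim-refines (to (ker _ _ _ _) eq))) (from (diag a a) refl))
      ; converse  = conv
      ; interNum  = λ i j a g a' g' eq → count-≡ i j (to (ker _ _ _ _) eq)
      }
      where
      conv : ∀ i → ∃[ j ] (∀ a b → (d a b ≡ i) ⇔ (d b a ≡ j))
      conv i with onto i
      ... | x , y , refl = d y x , λ a b →
        mk⇔ (λ h → from (ker _ _ _ _) (sim-flip (to (ker _ _ _ _) h)))
            (λ h → from (ker _ _ _ _) (sim-flip (to (ker _ _ _ _) h)))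

    singleton : SingletonBasis d α₀
    singleton a b = mk⇔
      (λ h → let s = to (ker _ _ _ _) h in col-≡α₀ (sym (left s)) , col-≡α₀ (sym (right s)))
      (λ { (refl , refl) → refl })

  -- Basis relations and fibers of the extension

  module Classes {m'} (d : Colouring n m') (ext : IsExtension c α₀ d) where
    open IsExtension ext
    module d = Coherent d isCC

    -- Transporting `α₀` along `(a , a)` gives a point with the diagonal colour of `α₀`. As `α₀` is
    -- isolated in `d`, that point is `α₀`, and refinement compares the spheres.
    sphere : ∀ {a b a' b'} → d a b ≡ d a' b' → col a ≡ col a'
    sphere {a} eq with d.transport (d.source eq) α₀
    ... | x , _ , α₀a≡xa' with proj₁ (to (singleton x x) (sym (d.source α₀a≡xa')))
    ...   | refl = refines _ _ _ _ α₀a≡xa'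

    -- Coherence of `d` moves the whole route through `δ`, and its colours determine both spheres
    -- and `c`-colours.
    d⇒sim : ∀ {a b a' b'} → d a b ≡ d a' b' → Sim a b a' b'
    d⇒sim {a} {b} {a'} {b'} eq = sim (sphere eq) (sphere (d.flip eq)) linked'
      where
      linked' : a ≢ α₀ → b ≢ α₀ → ∀ δ → D c e (col a) (col b) (col δ) →
                ∃[ δ' ] Linked a b a' b' δ δ'
      linked' _ _ δ _ with d.transport eq δ
      ... | δ' , h₁ , h₂ = δ' , sphere h₂ , refines _ _ _ _ h₁ , refines _ _ _ _ h₂

    -- The quotient by `Sim` is a coherent configuration that refines `c` and isolates `α₀`, so it
    -- refines the coarsest one.
    sim⇒d : ∀ {a b a' b'} → Sim a b a' b' → d a b ≡ d a' b'
    sim⇒d {a} {b} {a'} {b'} s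
      with quotient₂ (λ p q → Sim (proj₁ p) (proj₂ p) (proj₁ q) (proj₂ q))
             (record { refl = sim-refl ; sym = sim-sym ; trans = sim-trans })
             (λ p q → sim? (proj₁ p) (proj₂ p) (proj₁ q) (proj₂ q))
    ... | M , d' , onto , ker =
      coarsest M d' S.isCC S.singleton (λ _ _ _ _ h → sim-refines (to (ker _ _ _ _) h))
        a b a' b' (from (ker a b a' b') s)
      where module S = SimColouring d' onto ker

    Basis-≐ : ∀ a b → Basis d (d a b) ≐ Sim a b
    Basis-≐ a b x y = mk⇔ (λ h → d⇒sim (sym h)) (λ s → sym (sim⇒d s))

    -- Unfolds a class as a product in `S(u,w)·S(w,v)`: the point `δ'` of a link is the middle point
    -- of the composition.
    cut-≐ : ∀ a b δ → a ≢ α₀ → b ≢ α₀ → D c e (col a) (col b) (col δ) →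
      Sim a b ≐ (Cut c α₀ (c a δ) (col a) (col δ) ⨾ Cut c α₀ (c δ b) (col δ) (col b))
    cut-≐ a b δ a≢ b≢ Dδ x y = mk⇔ fwd bwd
      where
      fwd : Sim a b x y → _
      fwd s with linked s a≢ b≢ δ Dδ
      ... | δ' , l₁ , l₂ , l₃ =
        δ' , (sym l₂ , sym (left s) , sym l₁) , (sym l₃ , sym l₁ , sym (right s))
      bwd : _ → Sim a b x y
      bwd (δ' , (l₂ , l , l₁) , (l₃ , _ , r)) =
        link (sym l) (sym r) Dδ (sym l₁ , sym l₂ , sym l₃)

    simˡ-≐ : ∀ b → Sim α₀ b ≐ (λ x y → x ≡ α₀ × col y ≡ col b)
    simˡ-≐ b x y = mk⇔ (λ s → col-≡α₀ (left s) , sym (right s)) (λ { (refl , h) → simˡ (sym h) })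

    simʳ-≐ : ∀ a → Sim a α₀ ≐ (λ x y → col x ≡ col a × y ≡ α₀)
    simʳ-≐ a x y = mk⇔ (λ s → sym (left s) , col-≡α₀ (right s)) (λ { (h , refl) → simʳ (sym h) })

    ≐-trans : ∀ {r s t : Rel n} → r ≐ s → s ≐ t → r ≐ t
    ≐-trans h h' x y = ⇔-trans (h x y) (h' x y)

    ≐-sym : ∀ {r s : Rel n} → r ≐ s → s ≐ r
    ≐-sym h x y = ⇔-sym (h x y)

    classify : ∀ {R} a b → R ≐ Sim a b → InS₀ c e α₀ R ⊎ InS₁ c α₀ R
    classify a b R≐ with a ≟ α₀ | b ≟ α₀
    ... | yes refl | _ = inj₂ (col b , inj₁ (≐-trans R≐ (simˡ-≐ b)))
    ... | no _ | yes refl = inj₂ (col a , inj₂ (≐-trans R≐ (simʳ-≐ a)))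
    ... | no a≢ | no b≢ with middle a≢ b≢ a≢
    ...   | δ , Dδ , _ = inj₁ (col a , col b , col δ , col≢e a≢ , col≢e b≢ , Dδ ,
      c a δ , c δ b , (λ _ _ h → common (sym h)) , (λ _ _ h → common (sym h)) ,
      ≐-trans R≐ (cut-≐ a b δ a≢ b≢ Dδ))

    basis : ∀ {R} a b → R ≐ Sim a b → ∃[ j ] (R ≐ Basis d j)
    basis a b R≐ = d a b , ≐-trans R≐ (≐-sym (Basis-≐ a b))

    -- Every `s` in `u*w` meets the spheres around `α₀`, starting from any `a` of the `u`-sphere: a
    -- centre `ω` over an `s`-edge is transported to `α₀`.
    edge : ∀ {u w s} → InComp c (Basis c u ᵀ) (Basis c w) s → ∀ {a} → col a ≡ u →
           ∃[ b ] (col b ≡ w × c a b ≡ s)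
    edge {s = s} inc au with IsCC.nonempty cc s
    ... | x , y , xy≡s with inc x y xy≡s
    ... | ω , ωx , ωy with transport (trans ωx (sym au)) y
    ... | b , h₁ , h₂ = b , trans (sym h₁) ωy , trans (sym (flip h₂)) xy≡s

    S₀⇒basis : ∀ {R} → InS₀ c e α₀ R → ∃[ j ] (R ≐ Basis d j)
    S₀⇒basis (u , v , w , u≢e , v≢e , Dw , s , s' , inc , inc' , R≐) with neighbour α₀ u
    -- Following `s` and then `s'` from the `u`-sphere produces a representative `(a , b)` of the
    -- product.
    ... | a , refl with edge inc {a} refl
    ... | δ , refl , refl with edge inc' {δ} refl
    ... | b , refl , refl =
      basis a b (≐-trans R≐ (≐-sym (cut-≐ a b δ (≢α₀ u≢e) (≢α₀ v≢e) Dw)))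

    S₁⇒basis : ∀ {R} → InS₁ c α₀ R → ∃[ j ] (R ≐ Basis d j)
    S₁⇒basis (v , h) with neighbour α₀ v | h
    ... | b , refl | inj₁ R≐ = basis α₀ b (≐-trans R≐ (≐-sym (simˡ-≐ b)))
    ... | a , refl | inj₂ R≐ = basis a α₀ (≐-trans R≐ (≐-sym (simʳ-≐ a)))

    basis⇔S₀∪S₁ : ∀ R → (∃[ j ] (R ≐ Basis d j)) ⇔ (InS₀ c e α₀ R ⊎ InS₁ c α₀ R)
    basis⇔S₀∪S₁ R = mk⇔ fwd (λ { (inj₁ h) → S₀⇒basis h ; (inj₂ h) → S₁⇒basis h })
      where
      fwd : ∃[ j ] (R ≐ Basis d j) → InS₀ c e α₀ R ⊎ InS₁ c α₀ R
      fwd (j , R≐) with IsCC.nonempty isCC j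
      ... | a , b , refl = classify a b (≐-trans R≐ (Basis-≐ a b))

    semiregular : ∀ β → β ≢ α₀ → ∀ j → count (λ γ → ⌊ d β γ ≟ j ⌋) ≤ 1
    semiregular β β≢ j = count≤1 _ (λ h h' →
      sim-unique β≢ (d⇒sim (trans (⌊≟⌋-elim h) (sym (⌊≟⌋-elim h')))))

    diagonal-≐ : ∀ a → Basis d (d a a) ≐ (λ x y → x ≡ y × col x ≡ col a)
    diagonal-≐ a x y = mk⇔
      (λ h → IsCC.diagUnion isCC a x y (sym h) , sphere h)
      (λ { (refl , h) → sim⇒d (sim-diag h) })

    fibers : ∀ Δ → IsFiber d Δ ⇔ (∃[ u ] (∀ a → Δ a ⇔ (col a ≡ u)))
    fibers Δ = mk⇔ fwd bwd
      where
      fwd : IsFiber d Δ → ∃[ u ] (∀ a → Δ a ⇔ (col a ≡ u))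
      fwd (j , h) with IsCC.nonempty isCC j
      ... | a , b , refl with to (h a b) refl
      ... | refl , _ = col a , λ x → mk⇔
        (λ x∈Δ → proj₂ (to (diagonal-≐ a x x) (from (h x x) (refl , x∈Δ))))
        (λ eq → proj₂ (to (h x x) (from (diagonal-≐ a x x) (refl , eq))))
      bwd : ∃[ u ] (∀ a → Δ a ⇔ (col a ≡ u)) → IsFiber d Δ
      bwd (u , h) with neighbour α₀ u
      ... | a , refl = d a a , λ x y → mk⇔
        (λ eq → let p = to (diagonal-≐ a x y) eq in proj₁ p , from (h x) (proj₂ p))
        (λ { (x≡y , x∈Δ) → from (diagonal-≐ a x y) (x≡y , to (h x) x∈Δ) })

theorem4p4 : ∀ {n m} (c : Colouring n m) (e : Fin m) (k : ℕ) →
    IsCC c → IsDiagColour c e → Equivalenced c e k →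
    (∀ u v → u ≢ e → v ≢ e → ∀ w w' → D c e u v w → D c e u v w' →
    ∃[ z ] (D c e u w z × D c e u w' z × D c e v w z × D c e v w' z)) →
    (∀ u v w → u ≢ e → v ≢ e → w ≢ e →
    ∃[ z ] (D c e u v z × D c e v w z × D c e w u z)) →
    ∀ (α₀ : Fin n) m' (d : Colouring n m') → IsExtension c α₀ d →
    (∀ (R : Rel n) → (∃[ j ] (R ≐ Basis d j)) ⇔ (InS₀ c e α₀ R ⊎ InS₁ c α₀ R))
    × (∀ β → β ≢ α₀ → ∀ j → Basis d j ⊆ʳ (λ a b → a ≢ α₀ × b ≢ α₀) →
    count (λ γ → ⌊ d β γ ≟ j ⌋) ≤ 1)
    × (∀ (Δ : Fin n → Set) → IsFiber d Δ ⇔ (∃[ u ] (∀ a → Δ a ⇔ (c α₀ a ≡ u))))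
theorem4p4 c e k cc diag equi hypA hypB α₀ m' d ext =
  basis⇔S₀∪S₁ , (λ β β≢ j _ → semiregular β β≢ j) , fibers
  where
  open Extension c e k cc diag equi hypA hypB α₀
  open Classes d ext
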